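{- Let $n_1,n_2,n_3$ be integers with $3\le n_1,n_2\le n_3$, let $W$ be a basic landmark system for $K(\mathbf{n})$, and let $u=(n_1+1,n_2+1,n_3+1)$. Then $W\cup\{u\}$ is a resolving set of $K(\mathbf{n}+\mathbf{1})=K_{n_1+1}\times K_{n_2+1}\times K_{n_3+1}$ if and only if the landmark graph $\mathcal{G}(W)$ contains no bad $4$-cycle, no plain hex, and no rainbow $2$-$2$-triangle.
   Context: $K(\mathbf{n})=K_{n_1}\times K_{n_2}\times K_{n_3}$ is the direct product of complete graphs: vertices are triples $(x_1,x_2,x_3)$, $1\le x_i\le n_i$, adjacent iff they differ in every coordinate. A set $W$ of vertices is resolving if for every two distinct vertices $x,y\notin W$ some $w\in W$ has $d(x,w)\neq d(y,w)$ ($d$ = graph distance). Landmark graph: $W_{i,a}=\{w\in W: w_i=a\}$; $\mathcal{G}(W)$ is the hypergraph on $W$ whose hyperedges are the nonempty $W_{i,a}$, each colored $i$. A stick is a hyperedge with exactly two vertices, poofy if at least three. Basic landmark system for $K(\mathbf{n})$: a vertex set $W$ such that (1) $W_{i,a}\neq\emptyset$ for all $i\in\{1,2,3\}$, $1\le a\le n_i$; (2) $|W_{i,a}|\ge 2$ for all such $i,a$; (3) $|W_{i,a}\cap W_{j,b}|\le 1$ whenever $i\ne j$. Bad $4$-cycle: distinct $w_1,\dots,w_4\in W$ and $\{i,j,k\}=\{1,2,3\}$ such that $\{w_1,w_2\}$, $\{w_3,w_4\}$ are hyperedges of color $i$, $w_2,w_3$ lie in a common hyperedge of color $j$, and $w_4,w_1$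 lie in a common hyperedge of color $k$. Plain hex: distinct $w_1,\dots,w_6\in W$ and an ordering $(i,j,k)$ of $\{1,2,3\}$ with $\{w_1,w_2\},\{w_4,w_5\}$ hyperedges of color $i$, $\{w_2,w_3\},\{w_5,w_6\}$ of color $j$, $\{w_3,w_4\},\{w_6,w_1\}$ of color $k$. Rainbow $2$-$2$-triangle: distinct $w_1,w_2,w_3\in W$ and $\{i,j,k\}=\{1,2,3\}$ with $\{w_1,w_2\}$ a hyperedge of color $i$, $\{w_2,w_3\}$ a hyperedge of color $j$, and $w_1,w_3$ in a common hyperedge of color $k$. -}

module Defs where

open import Data.Fin using (Fin; inject₁; fromℕ)
open import Data.Fin.Patterns using (0F; 1F; 2F)
open import Data.Fin.Properties using (_≟_)
open import Data.List using (List; []; _∷_; length; filter; allFin; cartesianProduct)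
open import Data.List.Relation.Unary.All using (All)
open import Data.List.Relation.Unary.Unique.Propositional using (Unique)
open import Data.Nat using (ℕ; zero; suc; _≤_; _≥_)
open import Data.Product using (_×_; _,_; ∃-syntax)
open import Function using (_∘_)
open import Level using (0ℓ)
open import Relation.Binary using (Rel)
open import Relation.Binary.PropositionalEquality using (_≡_; _≢_)
open import Relation.Unary using (Pred; Decidable; Satisfiable; _∈_; _∉_; _≐_; _∩_; _∪_; ｛_｝)
open import Relation.Unary.Properties using (_∩?_)

module _ {V : Set} (_~_ : Rel V 0ℓ) where

  data Walk : V → V → ℕ → Set where
    nil  : ∀ {x} → Walk x x zero
    cons : ∀ {x y z k} → x ~ y → Walk y z k → Walk x z (suc k)

  IsDistance : V → V → ℕ → Set
  IsDistance x y d = Walk x y d × (∀ k → Walk x y k → d ≤ k)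

  -- d(x,w) ≠ d(y,w).  Both distances are required to be finite, which is no
  -- restriction in a connected graph such as a product of three K_m, m ≥ 3.
  Resolves : V → V → V → Set
  Resolves w x y =
    ∃[ d ] ∃[ e ] IsDistance x w d × IsDistance y w e × d ≢ e

  Resolving : Pred V 0ℓ → Set
  Resolving W = ∀ x y → x ∉ W → y ∉ W → x ≢ y → ∃[ w ] w ∈ W × Resolves w x y

-- Coordinate directions (and colors) 1, 2, 3 are 0F, 1F, 2F, and the values
-- 1, …, n_i of the i-th coordinate are the elements of Fin (n i).
Dims : Set
Dims = Fin 3 → ℕ

Vertex : Dims → Set
Vertex n = Fin (n 0F) × Fin (n 1F) × Fin (n 2F)

_at_ : ∀ {n} → Vertex n → (i : Fin 3) → Fin (n i)
(x₁ , x₂ , x₃) at 0F = x₁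
(x₁ , x₂ , x₃) at 1F = x₂
(x₁ , x₂ , x₃) at 2F = x₃

K : (n : Dims) → Rel (Vertex n) 0ℓ
K n x y = ∀ i → _at_ {n} x i ≢ _at_ {n} y i

vertices : (n : Dims) → List (Vertex n)
vertices n =
  cartesianProduct (allFin (n 0F)) (cartesianProduct (allFin (n 1F)) (allFin (n 2F)))

module _ {n : Dims} where

  ∣_∣ : {P : Pred (Vertex n) 0ℓ} → Decidable P → ℕ
  ∣ P? ∣ = length (filter P? (vertices n))

  _[_,_] : Pred (Vertex n) 0ℓ → (i : Fin 3) → Fin (n i) → Pred (Vertex n) 0ℓ
  W [ i , a ] = W ∩ (λ w → _at_ {n} w i ≡ a)

  _[_,_]? : {W : Pred (Vertex n) 0ℓ} → Decidable W →
            (i : Fin 3) (a : Fin (n i)) → Decidable (W [ i , a ])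
  W? [ i , a ]? = W? ∩? (λ w → _at_ {n} w i ≟ a)

  record BasicLandmarkSystem {W : Pred (Vertex n) 0ℓ} (W? : Decidable W) : Set where
    field
      nonempty  : ∀ i (a : Fin (n i)) → Satisfiable (W [ i , a ])
      atLeast2  : ∀ i (a : Fin (n i)) → ∣ W? [ i , a ]? ∣ ≥ 2
      intersect : ∀ i j (a : Fin (n i)) (b : Fin (n j)) → i ≢ j →
                  ∣ (W? [ i , a ]?) ∩? (W? [ j , b ]?) ∣ ≤ 1

  module LandmarkGraph (W : Pred (Vertex n) 0ℓ) where

    IsHyperedge : Fin 3 → Pred (Vertex n) 0ℓ → Set
    IsHyperedge i E = ∃[ a ] Satisfiable (W [ i , a ]) × E ≐ W [ i , a ]

    Stick : Fin 3 → Vertex n → Vertex n → Set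
    Stick i x y = x ≢ y × IsHyperedge i (｛ x ｝ ∪ ｛ y ｝)

    -- The hyperedge W [ i , a ] is nonempty here, since it contains x.
    CommonHyperedge : Fin 3 → Vertex n → Vertex n → Set
    CommonHyperedge i x y = ∃[ a ] x ∈ W [ i , a ] × y ∈ W [ i , a ]

    -- For colors, Unique (i ∷ j ∷ k ∷ []) says that {i, j, k} = {1, 2, 3}.
    record Bad4Cycle : Set where
      field
        i j k       : Fin 3
        colors      : Unique (i ∷ j ∷ k ∷ [])
        w₁ w₂ w₃ w₄ : Vertex n
        inW         : All W (w₁ ∷ w₂ ∷ w₃ ∷ w₄ ∷ [])
        distinct    : Unique (w₁ ∷ w₂ ∷ w₃ ∷ w₄ ∷ [])
        edge₁₂      : Stick i w₁ w₂
        edge₃₄      : Stick i w₃ w₄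
        edge₂₃      : CommonHyperedge j w₂ w₃
        edge₄₁      : CommonHyperedge k w₄ w₁

    record PlainHex : Set where
      field
        i j k             : Fin 3
        colors            : Unique (i ∷ j ∷ k ∷ [])
        w₁ w₂ w₃ w₄ w₅ w₆ : Vertex n
        inW               : All W (w₁ ∷ w₂ ∷ w₃ ∷ w₄ ∷ w₅ ∷ w₆ ∷ [])
        distinct          : Unique (w₁ ∷ w₂ ∷ w₃ ∷ w₄ ∷ w₅ ∷ w₆ ∷ [])
        edge₁₂            : Stick i w₁ w₂
        edge₄₅            : Stick i w₄ w₅
        edge₂₃            : Stick j w₂ w₃
        edge₅₆            : Stick j w₅ w₆
        edge₃₄            : Stick k w₃ w₄
        edge₆₁            : Stick k w₆ w₁

    record Rainbow22Triangle : Set where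
      field
        i j k    : Fin 3
        colors   : Unique (i ∷ j ∷ k ∷ [])
        w₁ w₂ w₃ : Vertex n
        inW      : All W (w₁ ∷ w₂ ∷ w₃ ∷ [])
        distinct : Unique (w₁ ∷ w₂ ∷ w₃ ∷ [])
        edge₁₂   : Stick i w₁ w₂
        edge₂₃   : Stick j w₂ w₃
        edge₁₃   : CommonHyperedge k w₁ w₃

_+𝟏 : Dims → Dims
n +𝟏 = suc ∘ n

module _ {n : Dims} where

  embed : Vertex n → Vertex (n +𝟏)
  embed (x₁ , x₂ , x₃) = inject₁ x₁ , inject₁ x₂ , inject₁ x₃

  -- W viewed as a set of vertices of K (n +𝟏).
  extend : Pred (Vertex n) 0ℓ → Pred (Vertex (n +𝟏)) 0ℓ
  extend W x = ∃[ w ] w ∈ W × embed w ≡ x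

-- The vertex (n₁+1, n₂+1, n₃+1) of K (n +𝟏).
corner : (n : Dims) → Vertex (n +𝟏)
corner n = fromℕ (n 0F) , fromℕ (n 1F) , fromℕ (n 2F)

{-# OPTIONS --safe #-}
-- In a product of three complete graphs of order at least 3, distinct vertices
-- are at distance 1 if they differ in every coordinate and at distance 2
-- otherwise.  Hence x and y are unresolved exactly when the same landmarks meet
-- them, i.e. share a coordinate with them.  If the same landmarks meet x and y
-- and x_i ≠ y_i, x_i ≤ n_i, then W_{i,x_i} ⊆ W_{j,y_j} ∪ W_{k,y_k}; it has at
-- least two elements and meets each of these in at most one, so it is a stick
-- with one end on y_j and the other on y_k.  Collecting these sticks gives a bad
-- 4-cycle, a rainbow 2-2-triangle or a plain hex according to whether x and y
-- differ in one, two or three coordinates.  Conversely each configuration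
-- spells out an unresolved pair; for the triangle this pair is
-- (a, n_j+1, c), (n_i+1, b, c).
module Submission where

open import Defs
open import Data.Empty using (⊥)
open import Data.Fin using (Fin; suc; inject₁; fromℕ)
open import Data.Fin.Patterns using (0F; 1F; 2F)
open import Data.Fin.Properties using (_≟_; all?; any?; fromℕ≢inject₁; inject₁-injective)
open import Data.Fin.Relation.Unary.Top using (view; ‵fromℕ; ‵inject₁)
open import Data.List using (List; []; _∷_; length)
open import Data.List.Membership.Propositional using (lose) renaming (_∈_ to _∈ˡ_)
open import Data.List.Membership.Propositional.Properties using (∈-allFin; ∈-cartesianProduct⁺; ∈-filter⁺; ∈-filter⁻)
open import Data.List.Relation.Unary.All using ([]; _∷_)
open import Data.List.Relation.Unary.AllPairs using ([]; _∷_)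
open import Data.List.Relation.Unary.Any as Any using (here; there; satisfied)
open import Data.List.Relation.Unary.Unique.Propositional using (Unique)
open import Data.List.Relation.Unary.Unique.Propositional.Properties using (allFin⁺; cartesianProduct⁺; filter⁺)
open import Data.Nat using (suc; _≤_; z≤n; s≤s)
open import Data.Nat.Properties using (≤-antisym; ≤-trans; m≤n⇒m≤1+n)
open import Data.Product using (_×_; _,_; ∃-syntax; proj₁; proj₂)
open import Data.Sum using (_⊎_; inj₁; inj₂) renaming ([_,_] to either)
open import Function using (_∘_)
open import Function.Bundles using (_⇔_; mk⇔)
open import Level using (0ℓ)
open import Relation.Binary.PropositionalEquality using (_≡_; _≢_; refl; sym; trans; cong; cong₂; ≢-sym)
open import Relation.Nullary using (¬_; Dec; yes; no; contradiction; ¬?; _×-dec_; _⊎-dec_; _→-dec_)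
open import Relation.Nullary.Decidable using (from-yes; decidable-stable)
open import Relation.Unary using (Pred; Decidable; _∈_; _∉_; _∪_; ｛_｝)
open import Relation.Unary.Properties using (_∩?_)

-- Lists of length at least two and at most one

module _ {A : Set} where

  Unique⇒two-distinct : {xs : List A} → Unique xs → 2 ≤ length xs →
                        ∃[ x ] ∃[ y ] x ∈ˡ xs × y ∈ˡ xs × x ≢ y
  Unique⇒two-distinct {_ ∷ []}    _                 (s≤s ())
  Unique⇒two-distinct {x ∷ y ∷ _} ((x≢y ∷ _) ∷ _) _ =
    x , y , here refl , there (here refl) , x≢y

  length≤1⇒∈-unique : {xs : List A} → length xs ≤ 1 → ∀ {x y} → x ∈ˡ xs → y ∈ˡ xs → x ≡ y
  length≤1⇒∈-unique {_ ∷ []}    _        (here refl) (here refl) = refl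
  length≤1⇒∈-unique {_ ∷ _ ∷ _} (s≤s ())

-- Colors

Colors : Fin 3 → Fin 3 → Fin 3 → Set
Colors i j k = Unique (i ∷ j ∷ k ∷ [])

colors : ∀ {i j k} → i ≢ j → i ≢ k → j ≢ k → Colors i j k
colors i≢j i≢k j≢k = (i≢j ∷ i≢k ∷ []) ∷ (j≢k ∷ []) ∷ [] ∷ []

first≢second : ∀ {i j k} → Colors i j k → i ≢ j
first≢second ((i≢j ∷ _) ∷ _) = i≢j

first≢third : ∀ {i j k} → Colors i j k → i ≢ k
first≢third ((_ ∷ i≢k ∷ []) ∷ _) = i≢k

rotate : ∀ {i j k} → Colors i j k → Colors j k i
rotate ((i≢j ∷ i≢k ∷ []) ∷ (j≢k ∷ []) ∷ [] ∷ []) = colors j≢k (≢-sym i≢j) (≢-sym i≢k)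

flip₁₂ : ∀ {i j k} → Colors i j k → Colors j i k
flip₁₂ ((i≢j ∷ i≢k ∷ []) ∷ (j≢k ∷ []) ∷ [] ∷ []) = colors (≢-sym i≢j) j≢k i≢k

flip₂₃ : ∀ {i j k} → Colors i j k → Colors i k j
flip₂₃ = rotate ∘ flip₁₂

-- Turns an unordered choice of the three colors into a case split on an arbitrary coordinate. The
-- finitely many quadruples in `Fin 3` are checked by evaluation.
cover : ∀ {i j k} → Colors i j k → ∀ l → l ≡ i ⊎ l ≡ j ⊎ l ≡ k
cover {i} {j} {k} ((i≢j ∷ i≢k ∷ []) ∷ (j≢k ∷ []) ∷ [] ∷ []) l =
  from-yes covers? i j k l i≢j i≢k j≢k
  where
  covers? : Dec (∀ (i j k l : Fin 3) → i ≢ j → i ≢ k → j ≢ k → l ≡ i ⊎ l ≡ j ⊎ l ≡ k)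
  covers? = all? λ i → all? λ j → all? λ k → all? λ l →
    ¬? (i ≟ j) →-dec ¬? (i ≟ k) →-dec ¬? (j ≟ k) →-dec (l ≟ i ⊎-dec l ≟ j ⊎-dec l ≟ k)

-- Vertices and distances

-- Supplies one coordinate of the middle vertex of a walk of length two.
avoid-two : ∀ {m} → 3 ≤ m → (a b : Fin m) → ∃[ c ] a ≢ c × c ≢ b
avoid-two (s≤s (s≤s (s≤s _))) 0F            0F            = 1F , (λ ()) , λ ()
avoid-two (s≤s (s≤s (s≤s _))) 0F            1F            = 2F , (λ ()) , λ ()
avoid-two (s≤s (s≤s (s≤s _))) 0F            (suc (suc _)) = 1F , (λ ()) , λ ()
avoid-two (s≤s (s≤s (s≤s _))) 1F            0F            = 2F , (λ ()) , λ ()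
avoid-two (s≤s (s≤s (s≤s _))) (suc (suc _)) 0F            = 1F , (λ ()) , λ ()
avoid-two (s≤s (s≤s (s≤s _))) (suc _)       (suc _)       = 0F , (λ ()) , λ ()

inject₁-or-top : ∀ {m} (c : Fin (suc m)) → (∃[ a ] c ≡ inject₁ a) ⊎ c ≡ fromℕ m
inject₁-or-top c with view c
... | ‵fromℕ     = inj₂ refl
... | ‵inject₁ a = inj₁ (a , refl)

module _ (m : Dims) where

  private
    _!_ = _at_ {m}

  at-ext : ∀ {x y} → (∀ l → x ! l ≡ y ! l) → x ≡ y
  at-ext eq = cong₂ _,_ (eq 0F) (cong₂ _,_ (eq 1F) (eq 2F))

  tuple : (∀ l → Fin (m l)) → Vertex m
  tuple f = f 0F , f 1F , f 2F

  at-tuple : ∀ f l → tuple f ! l ≡ f l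
  at-tuple f 0F = refl
  at-tuple f 1F = refl
  at-tuple f 2F = refl

  -- The three values have different types, so the coordinate function is built by matching on the
  -- equality that `cover` returns. Distinctness of the colors rules out its other branches.
  vertex-with : ∀ {i j k} → Colors i j k → (a : Fin (m i)) (b : Fin (m j)) (c : Fin (m k)) →
                ∃[ x ] x ! i ≡ a × x ! j ≡ b × x ! k ≡ c
  vertex-with {i} {j} {k} C@((i≢j ∷ i≢k ∷ []) ∷ (j≢k ∷ []) ∷ [] ∷ []) a b c =
    tuple f , trans (at-tuple f i) (at-i (cover C i))
            , trans (at-tuple f j) (at-j (cover C j))
            , trans (at-tuple f k) (at-k (cover C k))
    where
    pick : ∀ {l} → l ≡ i ⊎ l ≡ j ⊎ l ≡ k → Fin (m l)
    pick (inj₁ refl)        = a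
    pick (inj₂ (inj₁ refl)) = b
    pick (inj₂ (inj₂ refl)) = c

    f : ∀ l → Fin (m l)
    f l = pick (cover C l)

    at-i : ∀ e → pick {i} e ≡ a
    at-i (inj₁ refl)       = refl
    at-i (inj₂ (inj₁ i≡j)) = contradiction i≡j i≢j
    at-i (inj₂ (inj₂ i≡k)) = contradiction i≡k i≢k

    at-j : ∀ e → pick {j} e ≡ b
    at-j (inj₁ j≡i)         = contradiction (sym j≡i) i≢j
    at-j (inj₂ (inj₁ refl)) = refl
    at-j (inj₂ (inj₂ j≡k))  = contradiction j≡k j≢k

    at-k : ∀ e → pick {k} e ≡ c
    at-k (inj₁ k≡i)         = contradiction (sym k≡i) i≢k
    at-k (inj₂ (inj₁ k≡j))  = contradiction (sym k≡j) j≢k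
    at-k (inj₂ (inj₂ refl)) = refl

  vertices-complete : ∀ x → x ∈ˡ vertices m
  vertices-complete (a , b , c) =
    ∈-cartesianProduct⁺ (∈-allFin a) (∈-cartesianProduct⁺ (∈-allFin b) (∈-allFin c))

  vertices-unique : Unique (vertices m)
  vertices-unique =
    cartesianProduct⁺ (allFin⁺ (m 0F)) (cartesianProduct⁺ (allFin⁺ (m 1F)) (allFin⁺ (m 2F)))

  -- The complement of adjacency in `K m`; in particular every vertex meets itself.
  Meets : Vertex m → Vertex m → Set
  Meets x w = ∃[ l ] x ! l ≡ w ! l

  meets? : ∀ x w → Dec (Meets x w)
  meets? x w = any? λ l → x ! l ≟ w ! l

  ¬Meets⇒distance-1 : ∀ {x w} → ¬ Meets x w → IsDistance (K m) x w 1
  ¬Meets⇒distance-1 {x} {w} ¬meets = cons (λ l eq → ¬meets (l , eq)) nil , minimal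
    where
    minimal : ∀ k → Walk (K m) x w k → 1 ≤ k
    minimal _ nil        = contradiction (0F , refl) ¬meets
    minimal _ (cons _ _) = s≤s z≤n

  distance-unique : ∀ {x w d e} → IsDistance (K m) x w d → IsDistance (K m) x w e → d ≡ e
  distance-unique (p , p-min) (q , q-min) = ≤-antisym (p-min _ q) (q-min _ p)

  resolves-sym : ∀ {x y w} → Resolves (K m) w x y → Resolves (K m) w y x
  resolves-sym (d , e , d-dist , e-dist , d≢e) = e , d , e-dist , d-dist , ≢-sym d≢e

  module _ (3≤m : ∀ l → 3 ≤ m l) where

    Meets⇒distance-2 : ∀ {x w} → x ≢ w → Meets x w → IsDistance (K m) x w 2
    Meets⇒distance-2 {x} {w} x≢w (l , xₗ≡wₗ) =
      cons {y = tuple c} (λ i eq → proj₁ (proj₂ (avoid i)) (trans eq (at-tuple c i)))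
        (cons (λ i eq → proj₂ (proj₂ (avoid i)) (trans (sym (at-tuple c i)) eq)) nil) ,
      minimal
      where
      avoid = λ i → avoid-two (3≤m i) (x ! i) (w ! i)

      c : ∀ i → Fin (m i)
      c = proj₁ ∘ avoid

      minimal : ∀ k → Walk (K m) x w k → 2 ≤ k
      minimal _ nil                 = contradiction refl x≢w
      minimal _ (cons adj nil)      = contradiction xₗ≡wₗ (adj l)
      minimal _ (cons _ (cons _ _)) = s≤s (s≤s z≤n)

    separates⇒resolves : ∀ {x y w} → x ≢ w → Meets x w → ¬ Meets y w → Resolves (K m) w x y
    separates⇒resolves x≢w meets ¬meets =
      2 , 1 , Meets⇒distance-2 x≢w meets , ¬Meets⇒distance-1 ¬meets , λ ()

    -- Away from `w` itself, the distance to `w` is 2 or 1 according to whether the vertex meets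
    -- `w`.
    same-meets⇒¬resolves : ∀ {x y w} → x ≢ w → y ≢ w →
                           (Meets x w → Meets y w) → (Meets y w → Meets x w) →
                           ¬ Resolves (K m) w x y
    same-meets⇒¬resolves {x} {y} {w} x≢w y≢w to from (_ , _ , d-dist , e-dist , d≢e)
      with meets? x w
    ... | yes meets = d≢e (trans (distance-unique d-dist (Meets⇒distance-2 x≢w meets))
                                 (distance-unique (Meets⇒distance-2 y≢w (to meets)) e-dist))
    ... | no ¬meets = d≢e (trans (distance-unique d-dist (¬Meets⇒distance-1 ¬meets))
                                 (distance-unique (¬Meets⇒distance-1 (¬meets ∘ from)) e-dist))

module _ (n : Dims) (3≤n : ∀ l → 3 ≤ n l)
         (W : Pred (Vertex n) 0ℓ) (W? : Decidable W)
         (basic : BasicLandmarkSystem {n} W?) where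

  open BasicLandmarkSystem basic
  open LandmarkGraph {n} W

  private
    _!_  = _at_ {n}
    _!⁺_ = _at_ {n +𝟏}

    W⁺ : Pred (Vertex (n +𝟏)) 0ℓ
    W⁺ = extend {n} W ∪ ｛ corner n ｝

    emb : Vertex n → Vertex (n +𝟏)
    emb = embed {n}

    3≤n+𝟏 : ∀ l → 3 ≤ (n +𝟏) l
    3≤n+𝟏 = m≤n⇒m≤1+n ∘ 3≤n

  -- Consequences of the conditions on a basic landmark system

  two-on : ∀ i a → ∃[ s ] ∃[ t ] (W s × s ! i ≡ a) × (W t × t ! i ≡ a) × s ≢ t
  two-on i a =
    let Wᵢₐ?                    = _[_,_]? {n} W? i a
        s , t , s∈ , t∈ , s≢t = Unique⇒two-distinct (filter⁺ Wᵢₐ? (vertices-unique n)) (atLeast2 i a)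
    in s , t , proj₂ (∈-filter⁻ Wᵢₐ? {xs = vertices n} s∈) , proj₂ (∈-filter⁻ Wᵢₐ? {xs = vertices n} t∈) , s≢t

  -- Condition (3): both landmarks lie in the intersection of two hyperedges of different colors.
  at-two⇒≡ : ∀ {i j s t} → i ≢ j → W s → W t → s ! i ≡ t ! i → s ! j ≡ t ! j → s ≡ t
  at-two⇒≡ {i} {j} {s} {t} i≢j s∈W t∈W eqᵢ eqⱼ =
    length≤1⇒∈-unique (intersect i j (t ! i) (t ! j) i≢j)
      (∈-filter⁺ P? (vertices-complete n s) ((s∈W , eqᵢ) , (s∈W , eqⱼ)))
      (∈-filter⁺ P? (vertices-complete n t) ((t∈W , refl) , (t∈W , refl)))
    where
    P? = _[_,_]? {n} W? i (t ! i) ∩? _[_,_]? {n} W? j (t ! j)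

  -- Landmarks through a coordinate of a vertex of K (n +𝟏)

  -- For `t` in `W` this says that `t` lies in W_{l,a} with a the l-th coordinate of `x`. Comparing
  -- after `emb` allows that coordinate to be the new top value, where `On` never holds.
  On : Vertex (n +𝟏) → Vertex n → Fin 3 → Set
  On x t l = x !⁺ l ≡ emb t !⁺ l

  at-embed : ∀ t l → emb t !⁺ l ≡ inject₁ (t ! l)
  at-embed t 0F = refl
  at-embed t 1F = refl
  at-embed t 2F = refl

  On⇒≡ : ∀ {x s t} l → On x s l → On x t l → s ! l ≡ t ! l
  On⇒≡ {s = s} {t} l on-s on-t = inject₁-injective
    (trans (sym (at-embed s l)) (trans (trans (sym on-s) on-t) (at-embed t l)))

  On-resp : ∀ {x s t} l → On x s l → s ! l ≡ t ! l → On x t l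
  On-resp {s = s} {t} l on eq =
    trans on (trans (at-embed s l) (trans (cong inject₁ eq) (sym (at-embed t l))))

  On⇒¬top : ∀ {x t} l → On x t l → x !⁺ l ≢ corner n !⁺ l
  On⇒¬top {t = t} l on top = absurd l (trans (sym top) (trans on (at-embed t l)))
    where
    absurd : ∀ l → corner n !⁺ l ≢ inject₁ (t ! l)
    absurd 0F = fromℕ≢inject₁
    absurd 1F = fromℕ≢inject₁
    absurd 2F = fromℕ≢inject₁

  On-both⇒≡ : ∀ {i j x y s t} → i ≢ j → W s → W t →
              On x s i → On x t i → On y s j → On y t j → s ≡ t
  On-both⇒≡ {i} {j} i≢j s∈W t∈W sᵢ tᵢ sⱼ tⱼ = at-two⇒≡ i≢j s∈W t∈W (On⇒≡ i sᵢ tᵢ) (On⇒≡ j sⱼ tⱼ)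

  apart : ∀ {x y s t} l → x !⁺ l ≢ y !⁺ l → On x s l → On y t l → s ≢ t
  apart l x≢y on-s on-t refl = x≢y (trans on-s (sym on-t))

  Hit : Vertex (n +𝟏) → Fin 3 → Set
  Hit x l = ∃[ t ] W t × On x t l

  at-corner : ∀ l → corner n !⁺ l ≡ fromℕ (n l)
  at-corner 0F = refl
  at-corner 1F = refl
  at-corner 2F = refl

  hit-or-top : ∀ x l → Hit x l ⊎ x !⁺ l ≡ corner n !⁺ l
  hit-or-top x l with inject₁-or-top (x !⁺ l)
  ... | inj₂ top       = inj₂ (trans top (sym (at-corner l)))
  ... | inj₁ (a , xₗ≡a) =
    let t , t∈W , tₗ≡a = nonempty l a
    in inj₁ (t , t∈W , trans xₗ≡a (trans (cong inject₁ (sym tₗ≡a)) (sym (at-embed t l))))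

  -- Two different values cannot both be the top one. Hence, after exchanging `x` and `y` if
  -- necessary, a coordinate where they differ carries a landmark of `x`.
  ≢⇒hit : ∀ {x y} l → x !⁺ l ≢ y !⁺ l → Hit x l ⊎ Hit y l
  ≢⇒hit {x} {y} l x≢y with hit-or-top x l | hit-or-top y l
  ... | inj₁ hit  | _         = inj₁ hit
  ... | inj₂ _    | inj₁ hit  = inj₂ hit
  ... | inj₂ topx | inj₂ topy = contradiction (trans topx (sym topy)) x≢y

  common : ∀ {x s t} l → W s → W t → On x s l → On x t l → CommonHyperedge l s t
  common l s∈W t∈W on-s on-t = _ , (s∈W , On⇒≡ l on-s on-t) , (t∈W , refl)

  -- Kept one-sided because each stick arises from a single direction; an unresolved pair satisfies
  -- both.
  _≼_ : Vertex (n +𝟏) → Vertex (n +𝟏) → Set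
  x ≼ y = ∀ v → v ∈ W⁺ → Meets (n +𝟏) x v → Meets (n +𝟏) y v

  -- Unresolved pairs yield forbidden configurations

  module Crossing {i j k} (C : Colors i j k) {x y} (x≼y : x ≼ y) (x≢y : x !⁺ i ≢ y !⁺ i) where

    private
      i≢j = first≢second C
      i≢k = first≢third C

    -- The landmark meets `x`, hence `y`, and it cannot meet `y` in coordinate `i`, where it agrees
    -- with `x`.
    on-other : ∀ {t} → W t → On x t i → On y t j ⊎ On y t k
    on-other {t} t∈W on with x≼y (emb t) (inj₁ (t , t∈W , refl)) (i , on)
    ... | l , on′ with cover C l
    ... | inj₁ refl        = contradiction (trans on (sym on′)) x≢y
    ... | inj₂ (inj₁ refl) = inj₁ on′
    ... | inj₂ (inj₂ refl) = inj₂ on′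

    -- Of two landmarks on x_i one must lie on y_j: otherwise both lie on y_k, and sharing two
    -- coordinates they coincide.
    crossing : Hit x i → ∃[ p ] W p × On x p i × On y p j
    crossing (t , t∈W , on-t) with two-on i (t ! i)
    ... | r , s , (r∈W , rᵢ) , (s∈W , sᵢ) , r≢s
      with on-r ← On-resp i on-t (sym rᵢ) | on-s ← On-resp i on-t (sym sᵢ)
      with on-other r∈W on-r | on-other s∈W on-s
    ... | inj₁ rⱼ | _       = r , r∈W , on-r , rⱼ
    ... | inj₂ _  | inj₁ sⱼ = s , s∈W , on-s , sⱼ
    ... | inj₂ rₖ | inj₂ sₖ = contradiction (On-both⇒≡ i≢k r∈W s∈W on-r on-s rₖ sₖ) r≢s

    -- Any landmark on x_i lies on y_j or y_k, so it shares two coordinates with `p` or with `q` and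
    -- equals it.
    stick : ∀ {p q} → W p → W q → On x p i → On x q i → On y p j → On y q k → Stick i p q
    stick {p} {q} p∈W q∈W pᵢ qᵢ pⱼ qₖ =
      p≢q , p ! i , (p , p∈W , refl) ,
      (λ { (inj₁ refl) → p∈W , refl ; (inj₂ refl) → q∈W , On⇒≡ i qᵢ pᵢ }) ,
      λ (t∈W , tᵢ) → ends t∈W (On-resp i pᵢ (sym tᵢ))
      where
      ends : ∀ {t} → W t → On x t i → p ≡ t ⊎ q ≡ t
      ends t∈W tᵢ with on-other t∈W tᵢ
      ... | inj₁ tⱼ = inj₁ (On-both⇒≡ i≢j p∈W t∈W pᵢ tᵢ pⱼ tⱼ)
      ... | inj₂ tₖ = inj₂ (On-both⇒≡ i≢k q∈W t∈W qᵢ tᵢ qₖ tₖ)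

      p≢q : p ≢ q
      -- If the ends coincided, the hyperedge would be a single vertex, against condition (2).
      p≢q refl with two-on i (p ! i)
      ... | r , s , (r∈W , rᵢ) , (s∈W , sᵢ) , r≢s
        with ends r∈W (On-resp i pᵢ (sym rᵢ)) | ends s∈W (On-resp i pᵢ (sym sᵢ))
      ... | inj₁ refl | inj₁ refl = r≢s refl
      ... | inj₁ refl | inj₂ refl = r≢s refl
      ... | inj₂ refl | inj₁ refl = r≢s refl
      ... | inj₂ refl | inj₂ refl = r≢s refl

  open Crossing

  differ-in-one⇒bad4cycle : ∀ {i j k} → Colors i j k → ∀ {x y} → x ≼ y → y ≼ x →
    x !⁺ i ≢ y !⁺ i → x !⁺ j ≡ y !⁺ j → x !⁺ k ≡ y !⁺ k → Hit x i → Bad4Cycle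
  differ-in-one⇒bad4cycle {i} {j} {k} C {x} {y} x≼y y≼x xᵢ≢yᵢ xⱼ≡yⱼ xₖ≡yₖ hit@(_ , _ , on-h)
    with p , p∈W , pᵢ , pⱼ ← crossing C x≼y xᵢ≢yᵢ hit
       | q , q∈W , qᵢ , qₖ ← crossing (flip₂₃ C) x≼y xᵢ≢yᵢ hit
    = bad4cycle
    where
    hit-y : Hit y i
    hit-y with hit-or-top y i
    ... | inj₁ hit = hit
    -- If y_i were the top value, the corner would meet `y` and hence `x`; but every coordinate of
    -- `x` carries a landmark: x_i by assumption, x_j by `p`, x_k by `q`.
    ... | inj₂ top with y≼x (corner n) (inj₂ refl) (i , top)
    ... | l , topₗ with cover C l
    ... | inj₁ refl        = contradiction topₗ (On⇒¬top i on-h)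
    ... | inj₂ (inj₁ refl) = contradiction topₗ (On⇒¬top j (trans xⱼ≡yⱼ pⱼ))
    ... | inj₂ (inj₂ refl) = contradiction topₗ (On⇒¬top k (trans xₖ≡yₖ qₖ))

    bad4cycle : Bad4Cycle
    bad4cycle
      with r , r∈W , rᵢ , rⱼ ← crossing C y≼x (≢-sym xᵢ≢yᵢ) hit-y
         | s , s∈W , sᵢ , sₖ ← crossing (flip₂₃ C) y≼x (≢-sym xᵢ≢yᵢ) hit-y
      = record
      { colors   = C
      ; inW      = q∈W ∷ p∈W ∷ r∈W ∷ s∈W ∷ []
      ; distinct = (proj₁ qp ∷ apart i xᵢ≢yᵢ qᵢ rᵢ ∷ apart i xᵢ≢yᵢ qᵢ sᵢ ∷ [])
                 ∷ (apart i xᵢ≢yᵢ pᵢ rᵢ ∷ apart i xᵢ≢yᵢ pᵢ sᵢ ∷ [])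
                 ∷ (proj₁ rs ∷ []) ∷ [] ∷ []
      ; edge₁₂   = qp
      ; edge₃₄   = rs
      ; edge₂₃   = common j p∈W r∈W pⱼ (trans (sym xⱼ≡yⱼ) rⱼ)
      ; edge₄₁   = common k s∈W q∈W (trans (sym xₖ≡yₖ) sₖ) qₖ
      }
      where
      qp = stick (flip₂₃ C) x≼y xᵢ≢yᵢ q∈W p∈W qᵢ pᵢ qₖ pⱼ
      rs = stick C y≼x (≢-sym xᵢ≢yᵢ) r∈W s∈W rᵢ sᵢ rⱼ sₖ

  differ-in-two⇒triangle : ∀ {i j k} → Colors i j k → ∀ {x y} → x ≼ y → y ≼ x →
    x !⁺ i ≢ y !⁺ i → x !⁺ j ≢ y !⁺ j → x !⁺ k ≡ y !⁺ k → Hit x i → Rainbow22Triangle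
  differ-in-two⇒triangle {i} {j} {k} C x≼y y≼x xᵢ≢yᵢ xⱼ≢yⱼ xₖ≡yₖ hit
    with p , p∈W , pᵢ , pⱼ ← crossing C x≼y xᵢ≢yᵢ hit
       | q , q∈W , qᵢ , qₖ ← crossing (flip₂₃ C) x≼y xᵢ≢yᵢ hit
    -- The landmark `p` lies on y_j, so y_j is not the top value and a second stick starts at `p`.
    -- Its other end meets `q` in color `k` since x_k = y_k.
    with r , r∈W , rⱼ , rₖ ← crossing (rotate C) y≼x (≢-sym xⱼ≢yⱼ) (p , p∈W , pⱼ)
    = record
    { colors   = C
    ; inW      = q∈W ∷ p∈W ∷ r∈W ∷ []
    ; distinct = (proj₁ qp ∷ q≢r ∷ []) ∷ (proj₁ pr ∷ []) ∷ [] ∷ []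
    ; edge₁₂   = qp
    ; edge₂₃   = pr
    ; edge₁₃   = common k q∈W r∈W qₖ (trans (sym xₖ≡yₖ) rₖ)
    }
    where
    qp = stick (flip₂₃ C) x≼y xᵢ≢yᵢ q∈W p∈W qᵢ pᵢ qₖ pⱼ
    pr = stick (flip₁₂ C) y≼x (≢-sym xⱼ≢yⱼ) p∈W r∈W pⱼ rⱼ pᵢ rₖ

    q≢r : q ≢ r
    -- Otherwise `q` would share coordinates `i` and `j` with `p`.
    q≢r refl = proj₁ qp (On-both⇒≡ (first≢second C) q∈W p∈W qᵢ pᵢ rⱼ pⱼ)

  -- Each landmark found shows that the next coordinate is not the top value, so the sticks can be
  -- followed through x_i, y_j, x_k, y_i, x_j. The sixth stick closes the cycle because both `w₆`
  -- and `w₁` lie on y_k. Nonconsecutive vertices are apart in a coordinate where one lies on `x`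
  -- and the other on `y`.
  differ-in-three⇒hex : ∀ {i j k} → Colors i j k → ∀ {x y} → x ≼ y → y ≼ x →
    x !⁺ i ≢ y !⁺ i → x !⁺ j ≢ y !⁺ j → x !⁺ k ≢ y !⁺ k → Hit x i → PlainHex
  differ-in-three⇒hex {i} {j} {k} C x≼y y≼x xᵢ≢yᵢ xⱼ≢yⱼ xₖ≢yₖ hit
    with w₁ , ∈₁ , xᵢ₁ , yₖ₁ ← crossing (flip₂₃ C) x≼y xᵢ≢yᵢ hit
       | w₂ , ∈₂ , xᵢ₂ , yⱼ₂ ← crossing C x≼y xᵢ≢yᵢ hit
    with w₃ , ∈₃ , yⱼ₃ , xₖ₃ ← crossing (rotate C) y≼x (≢-sym xⱼ≢yⱼ) (w₂ , ∈₂ , yⱼ₂)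
    with w₄ , ∈₄ , xₖ₄ , yᵢ₄ ← crossing (rotate (rotate C)) x≼y xₖ≢yₖ (w₃ , ∈₃ , xₖ₃)
    with w₅ , ∈₅ , yᵢ₅ , xⱼ₅ ← crossing C y≼x (≢-sym xᵢ≢yᵢ) (w₄ , ∈₄ , yᵢ₄)
    with w₆ , ∈₆ , xⱼ₆ , yₖ₆ ← crossing (rotate C) x≼y xⱼ≢yⱼ (w₅ , ∈₅ , xⱼ₅)
    = record
    { colors   = C
    ; inW      = ∈₁ ∷ ∈₂ ∷ ∈₃ ∷ ∈₄ ∷ ∈₅ ∷ ∈₆ ∷ []
    ; distinct = (proj₁ w₁w₂ ∷ apart k (≢-sym xₖ≢yₖ) yₖ₁ xₖ₃ ∷ apart i xᵢ≢yᵢ xᵢ₁ yᵢ₄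
                    ∷ apart i xᵢ≢yᵢ xᵢ₁ yᵢ₅ ∷ ≢-sym (proj₁ w₆w₁) ∷ [])
               ∷ (proj₁ w₂w₃ ∷ apart i xᵢ≢yᵢ xᵢ₂ yᵢ₄ ∷ apart i xᵢ≢yᵢ xᵢ₂ yᵢ₅
                    ∷ apart j (≢-sym xⱼ≢yⱼ) yⱼ₂ xⱼ₆ ∷ [])
               ∷ (proj₁ w₃w₄ ∷ apart j (≢-sym xⱼ≢yⱼ) yⱼ₃ xⱼ₅
                    ∷ apart j (≢-sym xⱼ≢yⱼ) yⱼ₃ xⱼ₆ ∷ [])
               ∷ (proj₁ w₄w₅ ∷ apart k xₖ≢yₖ xₖ₄ yₖ₆ ∷ [])
               ∷ (proj₁ w₅w₆ ∷ []) ∷ [] ∷ []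
    ; edge₁₂   = w₁w₂
    ; edge₄₅   = w₄w₅
    ; edge₂₃   = w₂w₃
    ; edge₅₆   = w₅w₆
    ; edge₃₄   = w₃w₄
    ; edge₆₁   = w₆w₁
    }
    where
    w₁w₂ = stick (flip₂₃ C) x≼y xᵢ≢yᵢ ∈₁ ∈₂ xᵢ₁ xᵢ₂ yₖ₁ yⱼ₂
    w₂w₃ = stick (flip₁₂ C) y≼x (≢-sym xⱼ≢yⱼ) ∈₂ ∈₃ yⱼ₂ yⱼ₃ xᵢ₂ xₖ₃
    w₃w₄ = stick (flip₁₂ (rotate C)) x≼y xₖ≢yₖ ∈₃ ∈₄ xₖ₃ xₖ₄ yⱼ₃ yᵢ₄
    w₄w₅ = stick (flip₂₃ C) y≼x (≢-sym xᵢ≢yᵢ) ∈₄ ∈₅ yᵢ₄ yᵢ₅ xₖ₄ xⱼ₅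
    w₅w₆ = stick (flip₁₂ C) x≼y xⱼ≢yⱼ ∈₅ ∈₆ xⱼ₅ xⱼ₆ yᵢ₅ yₖ₆
    w₆w₁ = stick (flip₁₂ (rotate C)) y≼x (≢-sym xₖ≢yₖ) ∈₆ ∈₁ yₖ₆ yₖ₁ xⱼ₆ xᵢ₁

  Obstruction : Set
  Obstruction = Bad4Cycle ⊎ PlainHex ⊎ Rainbow22Triangle

  twins⇒obstruction : ∀ {x y} → x ≢ y → x ≼ y → y ≼ x → Obstruction
  twins⇒obstruction {x} {y} x≢y x≼y y≼x =
    cases (x !⁺ 0F ≟ y !⁺ 0F) (x !⁺ 1F ≟ y !⁺ 1F) (x !⁺ 2F ≟ y !⁺ 2F)
    where
    one : ∀ {i j k} → Colors i j k →
          x !⁺ i ≢ y !⁺ i → x !⁺ j ≡ y !⁺ j → x !⁺ k ≡ y !⁺ k → Obstruction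
    one {i} C ≢ᵢ ≡ⱼ ≡ₖ with ≢⇒hit i ≢ᵢ
    ... | inj₁ hit = inj₁ (differ-in-one⇒bad4cycle C x≼y y≼x ≢ᵢ ≡ⱼ ≡ₖ hit)
    ... | inj₂ hit = inj₁ (differ-in-one⇒bad4cycle C y≼x x≼y (≢-sym ≢ᵢ) (sym ≡ⱼ) (sym ≡ₖ) hit)

    two : ∀ {i j k} → Colors i j k →
          x !⁺ i ≢ y !⁺ i → x !⁺ j ≢ y !⁺ j → x !⁺ k ≡ y !⁺ k → Obstruction
    two {i} C ≢ᵢ ≢ⱼ ≡ₖ with ≢⇒hit i ≢ᵢ
    ... | inj₁ hit = inj₂ (inj₂ (differ-in-two⇒triangle C x≼y y≼x ≢ᵢ ≢ⱼ ≡ₖ hit))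
    ... | inj₂ hit =
      inj₂ (inj₂ (differ-in-two⇒triangle C y≼x x≼y (≢-sym ≢ᵢ) (≢-sym ≢ⱼ) (sym ≡ₖ) hit))

    three : ∀ {i j k} → Colors i j k →
            x !⁺ i ≢ y !⁺ i → x !⁺ j ≢ y !⁺ j → x !⁺ k ≢ y !⁺ k → Obstruction
    three {i} C ≢ᵢ ≢ⱼ ≢ₖ with ≢⇒hit i ≢ᵢ
    ... | inj₁ hit = inj₂ (inj₁ (differ-in-three⇒hex C x≼y y≼x ≢ᵢ ≢ⱼ ≢ₖ hit))
    ... | inj₂ hit =
      inj₂ (inj₁ (differ-in-three⇒hex C y≼x x≼y (≢-sym ≢ᵢ) (≢-sym ≢ⱼ) (≢-sym ≢ₖ) hit))

    012-c = colors {0F} {1F} {2F} (λ ()) (λ ()) (λ ())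
    120-c = rotate 012-c
    201-c = rotate 120-c

    cases : Dec (x !⁺ 0F ≡ y !⁺ 0F) → Dec (x !⁺ 1F ≡ y !⁺ 1F) → Dec (x !⁺ 2F ≡ y !⁺ 2F) → Obstruction
    cases (yes e₀) (yes e₁) (yes e₂) =
      contradiction (at-ext (n +𝟏) λ { 0F → e₀ ; 1F → e₁ ; 2F → e₂ }) x≢y
    cases (no d₀)  (yes e₁) (yes e₂) = one 012-c d₀ e₁ e₂
    cases (yes e₀) (no d₁)  (yes e₂) = one 120-c d₁ e₂ e₀
    cases (yes e₀) (yes e₁) (no d₂)  = one 201-c d₂ e₀ e₁
    cases (no d₀)  (no d₁)  (yes e₂) = two 012-c d₀ d₁ e₂
    cases (yes e₀) (no d₁)  (no d₂)  = two 120-c d₁ d₂ e₀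
    cases (no d₀)  (yes e₁) (no d₂)  = two 201-c d₂ d₀ e₁
    cases (no d₀)  (no d₁)  (no d₂)  = three 012-c d₀ d₁ d₂

  -- Resolving in the absence of forbidden configurations

  Separates : Vertex (n +𝟏) → Vertex (n +𝟏) → Vertex (n +𝟏) → Set
  Separates v x y = Meets (n +𝟏) x v × ¬ Meets (n +𝟏) y v

  separates? : ∀ v x y → Dec (Separates v x y)
  separates? v x y = meets? (n +𝟏) x v ×-dec ¬? (meets? (n +𝟏) y v)

  ¬separates⇒ : ∀ {v x y} → ¬ Separates v x y → Meets (n +𝟏) x v → Meets (n +𝟏) y v
  ¬separates⇒ {v} {x} {y} ¬sep meets =
    decidable-stable (meets? (n +𝟏) y v) λ ¬meets → ¬sep (meets , ¬meets)

  -- Constructively, a separating landmark comes from a search through all vertices, which is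
  -- possible because `W` is decidable.
  separated-or-≼ : ∀ x y → (∃[ v ] v ∈ W⁺ × Separates v x y) ⊎ x ≼ y
  separated-or-≼ x y
    with separates? (corner n) x y
       | Any.any? (λ t → W? t ×-dec separates? (emb t) x y) (vertices n)
  ... | yes sep | _ = inj₁ (corner n , inj₂ refl , sep)
  ... | no _    | yes found =
    let t , t∈W , sep = satisfied found in inj₁ (emb t , inj₁ (t , t∈W , refl) , sep)
  ... | no ¬sep | no ¬found = inj₂ λ
    { v (inj₂ refl)             → ¬separates⇒ ¬sep
    ; v (inj₁ (t , t∈W , refl)) →
        ¬separates⇒ λ sep → ¬found (lose (vertices-complete n t) (t∈W , sep))
    }

  ∉⇒≢ : ∀ {x v} → x ∉ W⁺ → v ∈ W⁺ → x ≢ v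
  ∉⇒≢ x∉ v∈ refl = x∉ v∈

  no-obstruction⇒resolving : ¬ Obstruction → Resolving (K (n +𝟏)) W⁺
  no-obstruction⇒resolving ¬obs x y x∉ y∉ x≢y with separated-or-≼ x y | separated-or-≼ y x
  ... | inj₁ (v , v∈ , x-meets , y-avoids) | _ =
    v , v∈ , separates⇒resolves (n +𝟏) 3≤n+𝟏 (∉⇒≢ x∉ v∈) x-meets y-avoids
  ... | inj₂ _ | inj₁ (v , v∈ , y-meets , x-avoids) =
    v , v∈ , resolves-sym (n +𝟏)
               (separates⇒resolves (n +𝟏) 3≤n+𝟏 (∉⇒≢ y∉ v∈) y-meets x-avoids)
  ... | inj₂ x≼y | inj₂ y≼x = contradiction (twins⇒obstruction x≢y x≼y y≼x) ¬obs

  -- Forbidden configurations yield unresolved pairs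

  twins⇒¬resolving : ∀ {x y} → x ∉ W⁺ → y ∉ W⁺ → x ≢ y → x ≼ y → y ≼ x →
                     ¬ Resolving (K (n +𝟏)) W⁺
  twins⇒¬resolving {x} {y} x∉ y∉ x≢y x≼y y≼x resolving =
    let v , v∈ , res = resolving x y x∉ y∉ x≢y
    in same-meets⇒¬resolves (n +𝟏) 3≤n+𝟏 (∉⇒≢ x∉ v∈) (∉⇒≢ y∉ v∈) (x≼y v v∈) (y≼x v v∈) res

  Stick⇒≡ : ∀ {i p q} → Stick i p q → p ! i ≡ q ! i
  Stick⇒≡ (_ , _ , _ , to , _) = trans (proj₂ (to (inj₁ refl))) (sym (proj₂ (to (inj₂ refl))))

  Stick-ends : ∀ {i p q} → Stick i p q → ∀ {x t} → On x p i → W t → On x t i → p ≡ t ⊎ q ≡ t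
  Stick-ends {i} (_ , _ , _ , to , from) pᵢ t∈W tᵢ =
    from (t∈W , trans (On⇒≡ i tᵢ pᵢ) (proj₂ (to (inj₁ refl))))

  Common⇒≡ : ∀ {l s t} → CommonHyperedge l s t → s ! l ≡ t ! l
  Common⇒≡ (_ , (_ , sₗ) , (_ , tₗ)) = trans sₗ (sym tₗ)

  -- The share of `x ≼ y` due to coordinate `l`. It is obtained from equal coordinates, from a top
  -- value, which no landmark attains, or from a stick whose two ends meet `y`.
  Covered : Vertex (n +𝟏) → Vertex (n +𝟏) → Fin 3 → Set
  Covered x y l = ∀ {t} → W t → On x t l → Meets (n +𝟏) y (emb t)

  ≡⇒Covered : ∀ {x y} l → x !⁺ l ≡ y !⁺ l → Covered x y l
  ≡⇒Covered l eq _ on = l , trans (sym eq) on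

  top⇒Covered : ∀ {x y} l → x !⁺ l ≡ corner n !⁺ l → Covered x y l
  top⇒Covered l top _ on = contradiction top (On⇒¬top l on)

  Stick⇒Covered : ∀ {i p q} → Stick i p q → ∀ {x y} → On x p i →
                  Meets (n +𝟏) y (emb p) → Meets (n +𝟏) y (emb q) → Covered x y i
  Stick⇒Covered st pᵢ p-meets q-meets t∈W tᵢ with Stick-ends st pᵢ t∈W tᵢ
  ... | inj₁ refl = p-meets
  ... | inj₂ refl = q-meets

  Covered⇒≼ : ∀ {i j k} → Colors i j k → ∀ {x y} →
              (Meets (n +𝟏) x (corner n) → Meets (n +𝟏) y (corner n)) →
              Covered x y i → Covered x y j → Covered x y k → x ≼ y
  Covered⇒≼ C top cᵢ cⱼ cₖ _ (inj₂ refl)             meets    = top meets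
  Covered⇒≼ C top cᵢ cⱼ cₖ _ (inj₁ (t , t∈W , refl)) (l , on) with cover C l
  ... | inj₁ refl        = cᵢ t∈W on
  ... | inj₂ (inj₁ refl) = cⱼ t∈W on
  ... | inj₂ (inj₂ refl) = cₖ t∈W on

  vertex-on : ∀ {i j k} → Colors i j k → (p q r : Vertex n) →
              ∃[ x ] On x p i × On x q j × On x r k
  vertex-on C p q r = vertex-with (n +𝟏) C _ _ _

  On⇒¬Meets-corner : ∀ {i j k} → Colors i j k → ∀ {x p q r} →
                     On x p i → On x q j → On x r k → ¬ Meets (n +𝟏) x (corner n)
  On⇒¬Meets-corner C pᵢ qⱼ rₖ (l , top) with cover C l
  ... | inj₁ refl        = On⇒¬top l pᵢ top
  ... | inj₂ (inj₁ refl) = On⇒¬top l qⱼ top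
  ... | inj₂ (inj₂ refl) = On⇒¬top l rₖ top

  ∉-W⁺ : ∀ {x p} i → On x p i → (∀ {t} → W t → (∀ l → On x t l) → ⊥) → x ∉ W⁺
  ∉-W⁺ i pᵢ ¬on (inj₁ (t , t∈W , refl)) = ¬on t∈W λ _ → refl
  ∉-W⁺ i pᵢ ¬on (inj₂ refl)             = On⇒¬top i pᵢ refl

  -- A landmark equal to `x` would be an end of the stick; it would then share a second coordinate
  -- with the other end.
  Stick⇒∉-W⁺ : ∀ {i j k} → Colors i j k → ∀ {x p q} → W p → W q → Stick i p q →
               On x p i → On x p j → On x q k → x ∉ W⁺
  Stick⇒∉-W⁺ {i} {j} {k} C {x} {p} {q} p∈W q∈W st@(p≢q , _) pᵢ pⱼ qₖ = ∉-W⁺ i pᵢ ¬on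
    where
    qᵢ : On x q i
    qᵢ = On-resp i pᵢ (Stick⇒≡ st)

    ¬on : ∀ {t} → W t → (∀ l → On x t l) → ⊥
    ¬on t∈W on with Stick-ends st pᵢ t∈W (on i)
    ... | inj₁ refl = p≢q (On-both⇒≡ (first≢third C) p∈W q∈W pᵢ qᵢ (on k) qₖ)
    ... | inj₂ refl = p≢q (On-both⇒≡ (first≢second C) p∈W q∈W pᵢ qᵢ pⱼ (on j))

  Stick⇒≢ : ∀ {i p q r} → Stick i p q → ∀ {x y} → On x p i → W r → On y r i →
            p ≢ r → q ≢ r → x ≢ y
  Stick⇒≢ st pᵢ r∈W rᵢ p≢r q≢r refl with Stick-ends st pᵢ r∈W rᵢ
  ... | inj₁ p≡r = p≢r p≡r
  ... | inj₂ q≡r = q≢r q≡r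

  -- A landmark equal to `x` would be an end of both sticks.
  disjoint-sticks⇒∉-W⁺ : ∀ {i j p q r s} → Stick i p q → Stick j r s → ∀ {x} →
                         On x p i → On x r j →
                         p ≢ r → p ≢ s → q ≢ r → q ≢ s → x ∉ W⁺
  disjoint-sticks⇒∉-W⁺ {i} {j} st st′ {x} pᵢ rⱼ p≢r p≢s q≢r q≢s = ∉-W⁺ i pᵢ ¬on
    where
    ¬on : ∀ {t} → W t → (∀ l → On x t l) → ⊥
    ¬on t∈W on with Stick-ends st pᵢ t∈W (on i) | Stick-ends st′ rⱼ t∈W (on j)
    ... | inj₁ refl | inj₁ refl = p≢r refl
    ... | inj₁ refl | inj₂ refl = p≢s refl
    ... | inj₂ refl | inj₁ refl = q≢r refl
    ... | inj₂ refl | inj₂ refl = q≢s refl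

  -- The unresolved pair of each configuration

  Bad4Cycle⇒¬resolving : Bad4Cycle → ¬ Resolving (K (n +𝟏)) W⁺
  Bad4Cycle⇒¬resolving record
    { i = i ; j = j ; k = k ; colors = C
    ; w₁ = w₁ ; w₂ = w₂ ; w₃ = w₃
    ; inW = ∈₁ ∷ ∈₂ ∷ ∈₃ ∷ ∈₄ ∷ []
    ; distinct = (_ ∷ 1≢3 ∷ _) ∷ (2≢3 ∷ _) ∷ _
    ; edge₁₂ = s₁₂ ; edge₃₄ = s₃₄ ; edge₂₃ = c₂₃ ; edge₄₁ = c₄₁ }
    -- The shared coordinates `j` and `k` are those of the two common hyperedges; coordinate `i` is
    -- that of the first stick for `x` and of the second for `y`.
    with x , xᵢ₁ , xⱼ₂ , xₖ₁ ← vertex-on C w₁ w₂ w₁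
       | y , yᵢ₃ , yⱼ₂ , yₖ₁ ← vertex-on C w₃ w₂ w₁
    = twins⇒¬resolving
        (Stick⇒∉-W⁺ (flip₂₃ C) ∈₁ ∈₂ s₁₂ xᵢ₁ xₖ₁ xⱼ₂)
        (Stick⇒∉-W⁺ C ∈₃ ∈₄ s₃₄ yᵢ₃ (On-resp j yⱼ₂ w₂ⱼ≡w₃ⱼ) (On-resp k yₖ₁ w₁ₖ≡w₄ₖ))
        (Stick⇒≢ s₁₂ xᵢ₁ ∈₃ yᵢ₃ 1≢3 2≢3)
        (Covered⇒≼ C (λ top → contradiction top (On⇒¬Meets-corner C xᵢ₁ xⱼ₂ xₖ₁))
          (Stick⇒Covered s₁₂ xᵢ₁ (k , yₖ₁) (j , yⱼ₂))
          (≡⇒Covered j (trans xⱼ₂ (sym yⱼ₂)))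
          (≡⇒Covered k (trans xₖ₁ (sym yₖ₁))))
        (Covered⇒≼ C (λ top → contradiction top (On⇒¬Meets-corner C yᵢ₃ yⱼ₂ yₖ₁))
          (Stick⇒Covered s₃₄ yᵢ₃ (j , On-resp j xⱼ₂ w₂ⱼ≡w₃ⱼ) (k , On-resp k xₖ₁ w₁ₖ≡w₄ₖ))
          (≡⇒Covered j (trans yⱼ₂ (sym xⱼ₂)))
          (≡⇒Covered k (trans yₖ₁ (sym xₖ₁))))
    where
    w₂ⱼ≡w₃ⱼ = Common⇒≡ c₂₃
    w₁ₖ≡w₄ₖ = sym (Common⇒≡ c₄₁)

  PlainHex⇒¬resolving : PlainHex → ¬ Resolving (K (n +𝟏)) W⁺
  PlainHex⇒¬resolving record
    { i = i ; j = j ; k = k ; colors = C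
    ; w₁ = w₁ ; w₂ = w₂ ; w₃ = w₃ ; w₄ = w₄ ; w₅ = w₅ ; w₆ = w₆
    ; inW = _ ∷ _ ∷ _ ∷ ∈₄ ∷ _
    ; distinct = (_ ∷ _ ∷ 1≢4 ∷ 1≢5 ∷ 1≢6 ∷ []) ∷ (_ ∷ 2≢4 ∷ 2≢5 ∷ 2≢6 ∷ [])
               ∷ (3≢4 ∷ 3≢5 ∷ _) ∷ _
    ; edge₁₂ = s₁₂ ; edge₄₅ = s₄₅ ; edge₂₃ = s₂₃ ; edge₅₆ = s₅₆ ; edge₃₄ = s₃₄ ; edge₆₁ = s₆₁ }
    -- Going around the hex, the sticks belong alternately to `x` and to `y`. Each end of a stick of
    -- one vertex thus lies on a stick of the other.
    with x , xᵢ₁ , xⱼ₅ , xₖ₃ ← vertex-on C w₁ w₅ w₃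
       | y , yᵢ₄ , yⱼ₂ , yₖ₆ ← vertex-on C w₄ w₂ w₆
    = twins⇒¬resolving
        (disjoint-sticks⇒∉-W⁺ s₁₂ s₅₆ xᵢ₁ xⱼ₅ 1≢5 1≢6 2≢5 2≢6)
        (disjoint-sticks⇒∉-W⁺ s₄₅ s₂₃ yᵢ₄ yⱼ₂
          (≢-sym 2≢4) (≢-sym 3≢4) (≢-sym 2≢5) (≢-sym 3≢5))
        (Stick⇒≢ s₁₂ xᵢ₁ ∈₄ yᵢ₄ 1≢4 2≢4)
        (Covered⇒≼ C (λ top → contradiction top (On⇒¬Meets-corner C xᵢ₁ xⱼ₅ xₖ₃))
          (Stick⇒Covered s₁₂ xᵢ₁ (k , On-resp k yₖ₆ (Stick⇒≡ s₆₁)) (j , yⱼ₂))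
          (Stick⇒Covered s₅₆ xⱼ₅ (i , On-resp i yᵢ₄ (Stick⇒≡ s₄₅)) (k , yₖ₆))
          (Stick⇒Covered s₃₄ xₖ₃ (j , On-resp j yⱼ₂ (Stick⇒≡ s₂₃)) (i , yᵢ₄)))
        (Covered⇒≼ C (λ top → contradiction top (On⇒¬Meets-corner C yᵢ₄ yⱼ₂ yₖ₆))
          (Stick⇒Covered s₄₅ yᵢ₄ (k , On-resp k xₖ₃ (Stick⇒≡ s₃₄)) (j , xⱼ₅))
          (Stick⇒Covered s₂₃ yⱼ₂ (i , On-resp i xᵢ₁ (Stick⇒≡ s₁₂)) (k , xₖ₃))
          (Stick⇒Covered s₆₁ yₖ₆ (j , On-resp j xⱼ₅ (Stick⇒≡ s₅₆)) (i , xᵢ₁)))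

  Rainbow22Triangle⇒¬resolving : Rainbow22Triangle → ¬ Resolving (K (n +𝟏)) W⁺
  Rainbow22Triangle⇒¬resolving record
    { i = i ; j = j ; k = k ; colors = C ; w₁ = w₁ ; w₂ = w₂
    ; edge₁₂ = s₁₂ ; edge₂₃ = s₂₃ ; edge₁₃ = c₁₃ }
    with x , xᵢ₁ , x-top , xₖ₁ ← vertex-with (n +𝟏) C (emb w₁ !⁺ i) (corner n !⁺ j) (emb w₁ !⁺ k)
       | y , y-top , yⱼ₂ , yₖ₁ ← vertex-with (n +𝟏) C (corner n !⁺ i) (emb w₂ !⁺ j) (emb w₁ !⁺ k)
    = twins⇒¬resolving
        (∉-W⁺ i xᵢ₁ λ _ on → On⇒¬top j (on j) x-top)
        (∉-W⁺ j yⱼ₂ λ _ on → On⇒¬top i (on i) y-top)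
        (λ { refl → On⇒¬top i xᵢ₁ y-top })
        (Covered⇒≼ C (λ _ → i , y-top)
          (Stick⇒Covered s₁₂ xᵢ₁ (k , yₖ₁) (j , yⱼ₂))
          (top⇒Covered j x-top)
          (≡⇒Covered k (trans xₖ₁ (sym yₖ₁))))
        (Covered⇒≼ C (λ _ → j , x-top)
          (top⇒Covered i y-top)
          (Stick⇒Covered s₂₃ yⱼ₂ (i , On-resp i xᵢ₁ (Stick⇒≡ s₁₂)) (k , On-resp k xₖ₁ (Common⇒≡ c₁₃)))
          (≡⇒Covered k (trans yₖ₁ (sym xₖ₁))))

mainTheorem4 : (n : Dims) →
    3 ≤ n 0F → n 0F ≤ n 2F → 3 ≤ n 1F → n 1F ≤ n 2F →
    (W : Pred (Vertex n) 0ℓ) (W? : Decidable W) →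
    BasicLandmarkSystem {n} W? →
    Resolving (K (n +𝟏)) (extend {n} W ∪ ｛ corner n ｝)
    ⇔ (¬ LandmarkGraph.Bad4Cycle {n} W
    × ¬ LandmarkGraph.PlainHex {n} W
    × ¬ LandmarkGraph.Rainbow22Triangle {n} W)
mainTheorem4 n 3≤n₀ n₀≤n₂ 3≤n₁ _ W W? basic = mk⇔
  (λ resolving → (λ c → Bad4Cycle⇒¬resolving n 3≤n W W? basic c resolving)
               , (λ h → PlainHex⇒¬resolving n 3≤n W W? basic h resolving)
               , (λ t → Rainbow22Triangle⇒¬resolving n 3≤n W W? basic t resolving))
  (λ (¬c , ¬h , ¬t) → no-obstruction⇒resolving n 3≤n W W? basic (either ¬c (either ¬h ¬t)))
  where
  3≤n : ∀ l → 3 ≤ n l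
  3≤n 0F = 3≤n₀
  3≤n 1F = 3≤n₁
  3≤n 2F = ≤-trans 3≤n₀ n₀≤n₂
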